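{- Let $r\ge 0$ and $n\ge 0$ be integers. Then the $r$-Bell number $B_{n,r}$ can be expressed in terms of the $r$-Lah numbers $\left\lfloor {n\atop k}\right\rfloor_r$ and the $r$-Stirling numbers of the second kind $\left\{ {n\atop k}\right\}_r$ by $$B_{n,r} = \sum_{k=0}^{n} (-1)^{n-k}\left\{ {n\atop k}\right\}_{r}\sum_{j=0}^{k} \left\lfloor {k\atop j}\right\rfloor_r .$$
   Context: For integers $r\ge 0$ and $0\le k\le n$: - $\left\{ {n\atop k}\right\}_r$ (the $r$-Stirling number of the second kind) is the number of partitions of a set with $n+r$ elements into $k+r$ nonempty subsets such that $r$ distinguished elements lie in distinct subsets; it satisfies $\left\{ {n+1\atop k}\right\}_{r}=\left\{ {n\atop k-1}\right\}_{r}+(k+r)\left\{ {n\atop k}\right\}_{r}$ with $\left\{ {0\atop 0}\right\}_r=1$. - $\left\lfloor {n\atop k}\right\rfloor_r$ (the $r$-Lah number) is the number of partitions of a set with $n+r$ elements into $k+r$ nonempty linearly ordered subsets such that $r$ distinguished elements lie in distinct ordered subsets; it satisfies $\left\lfloor {n+1\atop k}\right\rfloor_r= \left\lfloor {n\atop k-1}\right\rfloor_r+(n+k+2r) \left\lfloor {n\atop k}\right\rfloor_r$ with $\left\lfloor {0\atop 0}\right\rfloor_r=1$. Both kinds of numbers are $0$ when $k<0$ or $k>n$. The $r$-Bell numbers are $B_{n,r}=\sum_{k=0}^{n}\left\{ {n\atop k}\right\}_r$. -}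

module Defs where

open import Data.Fin.Base using (Fin; _↑ʳ_)
open import Data.Fin.Properties using (_≟_; all?; ≡-decSetoid)
open import Data.Integer.Base as ℤ using (ℤ; 0ℤ)
open import Data.List.Base
  using (List; []; _∷_; map; foldr; concat; concatMap; cartesianProductWith;
         filter; deduplicate; length; upTo; allFin)
import Data.List.Membership.DecPropositional as DecMembership
open import Data.List.Properties using (≡-dec)
import Data.List.Relation.Binary.Subset.DecSetoid as DecSubset
open import Data.List.Relation.Unary.All as All using (All)
open import Data.List.Relation.Unary.Unique.DecPropositional using (unique?)
open import Data.List.Relation.Unary.Unique.Propositional using (Unique)
open import Data.Nat.Base using (ℕ; zero; suc; _+_; _<_)
open import Data.Nat.ListAction using (sum)
open import Data.Nat.Properties using (_<?_)
open import Data.Product.Base using (_×_; _,_; swap)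
open import Level using (0ℓ)
open import Relation.Binary.Bundles using (DecSetoid)
open import Relation.Binary.PropositionalEquality.Core using (_≡_)
open import Relation.Binary.PropositionalEquality.Properties using (decSetoid)
open import Relation.Nullary.Decidable using (_×-dec_; _→-dec_)
open import Relation.Unary using (Decidable)

open module Membership {n : ℕ} = DecMembership (_≟_ {n}) using (_∈_; _∈?_)

-- The finite sets of elements of S: a list stands for the set of its entries,
-- so two lists are equal when each is contained in the other.
finiteSets : DecSetoid 0ℓ 0ℓ → DecSetoid 0ℓ 0ℓ
finiteSets S = record
  { Carrier = List A
  ; _≈_ = λ xs ys → (xs ⊆ ys) × (ys ⊆ xs)
  ; isDecEquivalence = record
    { isEquivalence = record
      { refl  = (λ x∈ → x∈) , (λ x∈ → x∈)
      ; sym   = swap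
      ; trans = λ (p , p′) (q , q′) → (λ x∈ → q (p x∈)) , (λ x∈ → p′ (q′ x∈))
      }
    ; _≟_ = λ xs ys → (xs ⊆? ys) ×-dec (ys ⊆? xs)
    }
  }
  where
  open DecSetoid S using () renaming (Carrier to A)
  open DecSubset S using (_⊆_; _⊆?_)

-- In a partition into subsets the blocks matter only as sets; in a partition
-- into linearly ordered subsets a block is the repetition-free list of its
-- elements in order. In both cases the blocks form a set.
setPartitions : ℕ → DecSetoid 0ℓ 0ℓ
setPartitions N = finiteSets (finiteSets (≡-decSetoid N))

orderedPartitions : ℕ → DecSetoid 0ℓ 0ℓ
orderedPartitions N = finiteSets (decSetoid (≡-dec (_≟_ {N})))

-- The ground set is Fin (n + r), and its last r elements n ↑ʳ i are the
-- distinguished ones. Disjointness of the blocks is part of the uniqueness of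
-- the entries of concat p.
IsRPartition : (n r : ℕ) → List (List (Fin (n + r))) → Set
IsRPartition n r p =
    All (λ b → 0 < length b) p
  × Unique (concat p)
  × (∀ x → x ∈ concat p)
  × All (λ b → ∀ (i j : Fin r) → (n ↑ʳ i) ∈ b → (n ↑ʳ j) ∈ b → i ≡ j) p

isRPartition? : (n r : ℕ) → Decidable (IsRPartition n r)
isRPartition? n r p =
        All.all? (λ b → 0 <? length b) p
  ×-dec unique? _≟_ (concat p)
  ×-dec all? (λ x → x ∈? concat p)
  ×-dec All.all? (λ b → all? λ i → all? λ j →
          ((n ↑ʳ i) ∈? b) →-dec ((n ↑ʳ j) ∈? b) →-dec (i ≟ j)) p

listsOfLength : {A : Set} → ℕ → List A → List (List A)
listsOfLength zero    xs = [] ∷ []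
listsOfLength (suc m) xs = cartesianProductWith _∷_ xs (listsOfLength m xs)

-- All lists of m blocks. A block of a partition has no repeated entries, so
-- blocks of length at most N suffice.
blockLists : (N m : ℕ) → List (List (List (Fin N)))
blockLists N m =
  listsOfLength m (concatMap (λ l → listsOfLength l (allFin N)) (upTo (suc N)))

rPartitions : (r n k : ℕ) → List (List (List (Fin (n + r))))
rPartitions r n k = filter (isRPartition? n r) (blockLists (n + r) (k + r))

-- The number of elements of a list, up to the equality of S.
numberOf : (S : DecSetoid 0ℓ 0ℓ) → List (DecSetoid.Carrier S) → ℕ
numberOf S xs = length (deduplicate (DecSetoid._≟_ S) xs)

rStirling₂ : (r n k : ℕ) → ℕ
rStirling₂ r n k = numberOf (setPartitions (n + r)) (rPartitions r n k)

rLah : (r n k : ℕ) → ℕ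
rLah r n k = numberOf (orderedPartitions (n + r)) (rPartitions r n k)

-- ∑≤ n f and ∑ℤ≤ n f are f 0 + f 1 + ⋯ + f n.
∑≤ : ℕ → (ℕ → ℕ) → ℕ
∑≤ n f = sum (map f (upTo (suc n)))

∑ℤ≤ : ℕ → (ℕ → ℤ) → ℤ
∑ℤ≤ n f = foldr ℤ._+_ 0ℤ (map f (upTo (suc n)))

rBell : (n r : ℕ) → ℕ
rBell n r = ∑≤ n (λ k → rStirling₂ r n k)

{-# OPTIONS --safe #-}

-- Deleting the element zero from a partition leaves a marked block, possibly
-- empty, and the other blocks. Reversing this enumerates the partitions of a set
-- with one more element up to equality of partitions, which gives the
-- recurrences of both kinds of numbers; only the number of places where zero
-- fits into a block depends on whether blocks are ordered. By the recurrence of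
-- the Stirling numbers S, the sums T(n, j) = ∑ₖ (-1)ⁿ⁻ᵏ S(n, k) L(k, j) satisfy
-- T(n+1, j) = ∑ₖ (-1)ⁿ⁻ᵏ S(n, k) (L(k+1, j) - (k+r) L(k, j)), which the
-- recurrence of the Lah numbers L turns into T(n, j-1) + (j+r) T(n, j). So
-- T(n, j) = S(n, j), and it remains to sum over j.

module Submission where

open import Defs
open import Data.Bool.Base using (if_then_else_)
open import Data.Fin.Base as Fin using (Fin; zero; suc; _↑ʳ_)
import Data.Fin.Properties as Fin
open import Data.Integer.Base as ℤ using (ℤ; +_; 0ℤ; 1ℤ; -1ℤ; _*_; _^_)
import Data.Integer.Properties as ℤ
open import Data.Integer.Tactic.RingSolver using (solve-∀)
open import Data.List.Base
  using (List; []; _∷_; [_]; _++_; map; concat; concatMap; foldr; applyUpTo; length; lookup; allFin)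
open import Data.List.Properties
  using (length-++; length-map; length-tabulate; map-++; map-cong; map-∘; map-upTo;
         concat-map; concat-map-[_]; concatMap-++; ∷-injectiveʳ; ≡-dec)
open import Data.List.Membership.Propositional using (_∈_; _∉_; find; lose)
open import Data.List.Membership.Propositional.Properties
import Data.List.Membership.Setoid as SetoidMembership
import Data.List.Membership.Setoid.Properties as SetoidMembershipₚ
open import Data.List.Relation.Binary.Permutation.Propositional
  using (_↭_; prep; swap; ↭-refl; ↭-sym; ↭-trans; ↭-reflexive; ↭⇒↭ₛ)
open import Data.List.Relation.Binary.Permutation.Propositional.Properties
  using (All-resp-↭; Any-resp-↭; ∈-resp-↭; ↭-length; shift)
  renaming (++⁺ˡ to ↭-++⁺ˡ; ++⁺ʳ to ↭-++⁺ʳ; shifts to ↭-shifts)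
import Data.List.Relation.Binary.Permutation.Setoid.Properties as Permutationₛ
open import Data.List.Relation.Unary.All as All using (All; []; _∷_)
import Data.List.Relation.Unary.All.Properties as All
open import Data.List.Relation.Unary.AllPairs as AllPairs using (AllPairs; []; _∷_)
import Data.List.Relation.Unary.AllPairs.Properties as AllPairs
open import Data.List.Relation.Unary.Any as Any using (Any; here; there)
import Data.List.Relation.Unary.Any.Properties as Any
open import Data.List.Relation.Unary.Unique.Propositional using (Unique)
import Data.List.Relation.Unary.Unique.Propositional.Properties as Unique
import Data.List.Relation.Unary.Unique.Setoid as UniqueSetoid
import Data.List.Relation.Unary.Unique.DecSetoid.Properties as UniqueDec
open import Data.Nat.Base as ℕ using (ℕ; zero; suc; _+_; _∸_; _≤_; _<_; s≤s; z≤n)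
open import Data.Nat.ListAction using (sum)
import Data.Nat.Properties as ℕ
open import Data.Product.Base using (_×_; _,_; proj₁; proj₂; ∃)
open import Data.Product.Relation.Binary.Pointwise.NonDependent using (_×ₛ_)
open import Data.Sum.Base using (inj₁; inj₂)
open import Data.Unit.Base using (⊤; tt)
open import Function.Base using (_∘_; id)
open import Level using (0ℓ)
open import Relation.Binary.Bundles using (Setoid; DecSetoid)
open import Relation.Binary.Core using (Rel)
open import Relation.Binary.PropositionalEquality
  using (_≡_; _≢_; refl; sym; trans; cong; cong₂; subst; setoid; module ≡-Reasoning)
open import Relation.Binary.PropositionalEquality.Properties using (decSetoid)
open import Relation.Binary.Structures using (IsDecEquivalence)
open import Relation.Nullary using (¬_; Dec; does; yes; no; contradiction)
open import Relation.Nullary.Decidable using (dec-true; dec-false)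
open import Relation.Unary using (Pred; _∪_)

-- Both counts are numbers of equivalence classes of lists, and the classes have no chosen
-- representatives. The recurrences are therefore not proved on the deduplicated search results: any
-- two complete lists of pairwise inequivalent representatives have the same length, so a list built
-- by induction can replace the search. The price is that each construction must respect and reflect
-- equality of partitions. The two terms of a recurrence are the two fates of the marked block: it
-- is empty when zero was a block by itself, and nonempty when zero shared its block. The inversion
-- succeeds because the Lah weight `k + r + (j + r)` of row k and column j is the sum of the
-- Stirling weights `k + r` and `j + r`: the first cancels against the subtracted term, and the
-- second is the weight in the Stirling recurrence for column j.

Unique-resp-↭ : {A : Set} {xs ys : List A} → xs ↭ ys → Unique xs → Unique ys
Unique-resp-↭ {A} xs↭ys = Permutationₛ.Unique-resp-↭ (setoid A) (↭⇒↭ₛ xs↭ys)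

Unique-++⁻ˡ : {A : Set} (xs : List A) {ys : List A} → Unique (xs ++ ys) → Unique xs
Unique-++⁻ˡ []       _         = []
Unique-++⁻ˡ (x ∷ xs) (x∉ ∷ u) = All.++⁻ˡ xs x∉ ∷ Unique-++⁻ˡ xs u

Unique-++⁻ʳ : {A : Set} (xs : List A) {ys : List A} → Unique (xs ++ ys) → Unique ys
Unique-++⁻ʳ []       u        = u
Unique-++⁻ʳ (x ∷ xs) (_ ∷ u) = Unique-++⁻ʳ xs u

Unique-++⇒disjoint : {A : Set} {xs ys : List A} {z : A} →
                     Unique (xs ++ ys) → z ∈ xs → z ∉ ys
Unique-++⇒disjoint {xs = x ∷ xs} (x∉ ∷ _) (here refl) z∈ys =
  All.lookup (All.++⁻ʳ xs x∉) z∈ys refl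
Unique-++⇒disjoint {xs = x ∷ xs} (_ ∷ u) (there z∈xs) z∈ys =
  Unique-++⇒disjoint u z∈xs z∈ys

length-concatMap : {A B : Set} (f : A → List B) (xs : List A) →
                   length (concatMap f xs) ≡ sum (map (length ∘ f) xs)
length-concatMap f []       = refl
length-concatMap f (x ∷ xs) =
  trans (length-++ (f x)) (cong (length (f x) ℕ.+_) (length-concatMap f xs))

sum-map-const : {A : Set} {f : A → ℕ} {c : ℕ} {xs : List A} →
                All (λ x → f x ≡ c) xs → sum (map f xs) ≡ c ℕ.* length xs
sum-map-const {c = c} []         = sym (ℕ.*-zeroʳ c)
sum-map-const {c = c} {_ ∷ xs} (fx≡c ∷ eqs) =
  trans (cong₂ ℕ._+_ fx≡c (sum-map-const eqs)) (sym (ℕ.*-suc c (length xs)))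

concatMap-concatMap : {A B C : Set} (f : B → List C) (g : A → List B) (xs : List A) →
                      concatMap f (concatMap g xs) ≡ concatMap (concatMap f ∘ g) xs
concatMap-concatMap f g []       = refl
concatMap-concatMap f g (x ∷ xs) =
  trans (concatMap-++ f (g x) (concatMap g xs))
        (cong (concatMap f (g x) ++_) (concatMap-concatMap f g xs))

-- Enumerations up to an equivalence

module _ (S : Setoid 0ℓ 0ℓ) where
  open Setoid S using (_≈_) renaming (Carrier to A; sym to ≈-sym)
  open SetoidMembership S using () renaming (_∈_ to _∈ₛ_)
  open UniqueSetoid S using () renaming (Unique to Uniqueₛ)

  -- Exactly one representative of each class that meets `P`. Since completeness is membership up to
  -- `_≈_`, the length depends on `P` alone.
  record Enumerates (P : Pred A 0ℓ) (xs : List A) : Set where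
    field
      sound    : All P xs
      distinct : Uniqueₛ xs
      complete : ∀ {x} → P x → x ∈ₛ xs

  lookup-injective : ∀ {xs} → Uniqueₛ xs → ∀ {i j} → lookup xs i ≈ lookup xs j → i ≡ j
  lookup-injective (_ ∷ _)  {zero}  {zero}  _  = refl
  lookup-injective (x∉ ∷ _) {zero}  {suc j} eq = contradiction eq (All.lookup x∉ (∈-lookup j))
  lookup-injective (x∉ ∷ _) {suc i} {zero}  eq =
    contradiction (≈-sym eq) (All.lookup x∉ (∈-lookup i))
  lookup-injective (_ ∷ u)  {suc i} {suc j} eq = cong suc (lookup-injective u eq)

  -- Pigeonhole on positions: two positions of `xs` sent to the same position of `ys` hold
  -- equivalent entries, so they coincide.
  length-mono-≤ : ∀ {xs ys} → Uniqueₛ xs → All (_∈ₛ ys) xs → length xs ≤ length ys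
  length-mono-≤ {xs} {ys} xs! xs⊆ys = Fin.injective⇒≤ {f = λ i → Any.index (member i)} λ {i} {j} eq →
    lookup-injective xs! (SetoidMembershipₚ.index-injective S (member i) (member j) eq)
    where
    member : ∀ i → lookup xs i ∈ₛ ys
    member i = All.lookup xs⊆ys (∈-lookup i)

  enumerations-length : ∀ {P xs ys} → Enumerates P xs → Enumerates P ys → length xs ≡ length ys
  enumerations-length exs eys = ℕ.≤-antisym (le exs eys) (le eys exs)
    where
    le : ∀ {P xs ys} → Enumerates P xs → Enumerates P ys → length xs ≤ length ys
    le exs eys = length-mono-≤ (Enumerates.distinct exs)
                               (All.map (Enumerates.complete eys) (Enumerates.sound exs))

  Enumerates-++ : ∀ {P Q xs ys} → (∀ {x y} → P x → Q y → ¬ x ≈ y) →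
                  Enumerates P xs → Enumerates Q ys → Enumerates (P ∪ Q) (xs ++ ys)
  Enumerates-++ {xs = xs} P≉Q exs eys = record
    { sound    = All.++⁺ (All.map inj₁ X.sound) (All.map inj₂ Y.sound)
    ; distinct = AllPairs.++⁺ X.distinct Y.distinct
                   (All.map (λ Px → All.map (P≉Q Px) Y.sound) X.sound)
    ; complete = λ { (inj₁ Px) → Any.++⁺ˡ (X.complete Px)
                   ; (inj₂ Qx) → Any.++⁺ʳ xs (Y.complete Qx) }
    }
    where module X = Enumerates exs
          module Y = Enumerates eys

  Enumerates-empty : ∀ {P} → (∀ {x} → ¬ P x) → Enumerates P []
  Enumerates-empty ¬P = record
    { sound = [] ; distinct = [] ; complete = λ Px → contradiction Px ¬P }

  Enumerates-singleton : ∀ {P x} → P x → (∀ {y} → P y → y ≈ x) → Enumerates P [ x ]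
  Enumerates-singleton Px P≈x = record
    { sound = Px ∷ [] ; distinct = [] ∷ [] ; complete = λ Py → here (P≈x Py) }

module _ (S : DecSetoid 0ℓ 0ℓ) where
  open DecSetoid S using (_≟_; reflexive) renaming (Carrier to A; setoid to S′)

  -- Deduplicating `xs` gives another enumeration of `P`, so its length can be read off any
  -- convenient `ys`.
  numberOf-enumerated : ∀ {P : Pred A 0ℓ} {xs ys} → All P xs → (∀ {x} → P x → x ∈ xs) →
                        Enumerates S′ P ys → numberOf S xs ≡ length ys
  numberOf-enumerated {xs = xs} sound complete = enumerations-length S′ record
    { sound    = All.anti-mono (∈-deduplicate⁻ _≟_ xs) sound
    ; distinct = UniqueDec.deduplicate-! S xs
    ; complete = λ Px → SetoidMembershipₚ.∈-deduplicate⁺ S′ _≟_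
        (λ p q → DecSetoid.trans S q (DecSetoid.sym S p))
        (Any.map reflexive (complete Px))
    }

module _ (S T : Setoid 0ℓ 0ℓ) where
  private
    module S = Setoid S
    module T = Setoid T
  open SetoidMembership T using () renaming (_∈_ to _∈ₜ_)

  -- Reflection of equality keeps the lists for inequivalent arguments disjoint. A preimage `x` of
  -- `y` need not itself be listed in `xs`, only some equivalent `x′`; hence the last condition on
  -- `f` has to serve every such `x′`.
  Enumerates-concatMap :
    ∀ {P Q xs} (f : S.Carrier → List T.Carrier) →
    (∀ {x} → P x → All Q (f x)) →
    (∀ {x} → P x → UniqueSetoid.Unique T (f x)) →
    (∀ {x x′ y y′} → y ∈ f x → y′ ∈ f x′ → y T.≈ y′ → x S.≈ x′) →
    (∀ {y} → Q y → ∃ λ x → P x × (∀ {x′} → P x′ → x S.≈ x′ → y ∈ₜ f x′)) →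
    Enumerates S P xs → Enumerates T Q (concatMap f xs)
  Enumerates-concatMap {xs = xs} f f-sound f-distinct f-reflects f-complete e = record
    { sound    = All.concat⁺ (All.map⁺ (All.map f-sound sound))
    ; distinct = AllPairs.concat⁺ (All.map⁺ (All.map f-distinct sound))
        (AllPairs.map⁺ (AllPairs.map
          (λ x≉x′ → All.tabulate λ y∈ → All.tabulate λ y′∈ y≈y′ → x≉x′ (f-reflects y∈ y′∈ y≈y′))
          distinct))
    ; complete = λ Qy → let x , Px , y∈f = f-complete Qy
                            x′ , x′∈xs , x≈x′ = find (complete Px)
                        in Any.concat⁺ (Any.map⁺ (lose x′∈xs (y∈f (All.lookup sound x′∈xs) x≈x′)))
    }
    where open Enumerates e
-- Deleting and inserting the element zero

strip : ∀ {N} → List (Fin (suc N)) → List (Fin N)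
strip []           = []
strip (zero  ∷ xs) = strip xs
strip (suc x ∷ xs) = x ∷ strip xs

strip-map-suc : ∀ {N} (b : List (Fin N)) → strip (map suc b) ≡ b
strip-map-suc []      = refl
strip-map-suc (x ∷ b) = cong (x ∷_) (strip-map-suc b)

map-suc-strip : ∀ {N} {c : List (Fin (suc N))} → zero ∉ c → map suc (strip c) ≡ c
map-suc-strip {c = []}        z∉ = refl
map-suc-strip {c = zero  ∷ c} z∉ = contradiction (here refl) z∉
map-suc-strip {c = suc x ∷ c} z∉ = cong (suc x ∷_) (map-suc-strip (z∉ ∘ there))

zero∉map-suc : ∀ {N} {b : List (Fin N)} → Fin.zero ∉ map Fin.suc b
zero∉map-suc z∈ with ∈-map⁻ suc z∈
... | _ , _ , ()

suc∈map-suc⁻ : ∀ {N} {b : List (Fin N)} {x} → suc x ∈ map suc b → x ∈ b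
suc∈map-suc⁻ sx∈ with ∈-map⁻ suc sx∈
... | _ , x∈ , refl = x∈

∈-strip⁻ : ∀ {N} (c : List (Fin (suc N))) {x} → x ∈ strip c → suc x ∈ c
∈-strip⁻ (zero  ∷ c) x∈         = there (∈-strip⁻ c x∈)
∈-strip⁻ (suc y ∷ c) (here eq)  = here (cong suc eq)
∈-strip⁻ (suc y ∷ c) (there x∈) = there (∈-strip⁻ c x∈)

∈-strip⁺ : ∀ {N} {c : List (Fin (suc N))} {x} → suc x ∈ c → x ∈ strip c
∈-strip⁺ {c = zero  ∷ c} (there x∈)  = ∈-strip⁺ x∈
∈-strip⁺ {c = suc y ∷ c} (here refl) = here refl
∈-strip⁺ {c = suc y ∷ c} (there x∈)  = there (∈-strip⁺ x∈)

-- By uniqueness zero occurs only once, so `strip` loses a single entry.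
strip-↭ : ∀ {N} {c : List (Fin (suc N))} → zero ∈ c → Unique c → c ↭ zero ∷ map suc (strip c)
strip-↭ {c = zero  ∷ c} z∈ (z∉ ∷ _) =
  ↭-reflexive (cong (zero ∷_) (sym (map-suc-strip λ z∈c → All.lookup z∉ z∈c refl)))
strip-↭ {c = suc x ∷ c} (there z∈) (_ ∷ u) =
  ↭-trans (prep (suc x) (strip-↭ z∈ u)) (swap (suc x) zero ↭-refl)

mutual
  -- Setting the later places apart lets the first entry appear by reduction for any `b`, even for a
  -- term such as `strip c` that is not in constructor form.
  zeroInsertions : ∀ {N} → List (Fin N) → List (List (Fin (suc N)))
  zeroInsertions b = (zero ∷ map suc b) ∷ laterZeroInsertions b

  laterZeroInsertions : ∀ {N} → List (Fin N) → List (List (Fin (suc N)))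
  laterZeroInsertions []      = []
  laterZeroInsertions (x ∷ b) = map (suc x ∷_) (zeroInsertions b)

zeroInsertions-↭ : ∀ {N} (b : List (Fin N)) → All (_↭ zero ∷ map suc b) (zeroInsertions b)
zeroInsertions-↭ []      = ↭-refl ∷ []
zeroInsertions-↭ (x ∷ b) = ↭-refl ∷ All.map⁺ (All.map
  (λ c↭ → ↭-trans (prep (suc x) c↭) (swap (suc x) zero ↭-refl)) (zeroInsertions-↭ b))

zeroInsertions-strip : ∀ {N} (b : List (Fin N)) → All (λ c → strip c ≡ b) (zeroInsertions b)
zeroInsertions-strip []      = refl ∷ []
zeroInsertions-strip (x ∷ b) =
  strip-map-suc (x ∷ b) ∷ All.map⁺ (All.map (cong (x ∷_)) (zeroInsertions-strip b))

zeroInsertions-unique : ∀ {N} (b : List (Fin N)) → Unique (zeroInsertions b)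
zeroInsertions-unique []      = [] ∷ []
zeroInsertions-unique (x ∷ b) =
  All.map⁺ (All.tabulate λ _ → first≢) ∷
  Unique.map⁺ {f = suc x ∷_} ∷-injectiveʳ (zeroInsertions-unique b)
  where
  first≢ : {c d : List (Fin (suc _))} → zero ∷ c ≢ suc x ∷ d
  first≢ ()

zeroInsertions-complete : ∀ {N} {c : List (Fin (suc N))} → zero ∈ c → Unique c →
                          c ∈ zeroInsertions (strip c)
zeroInsertions-complete {c = zero ∷ c} z∈ (z∉ ∷ _) =
  here (cong (zero ∷_) (sym (map-suc-strip λ z∈c → All.lookup z∉ z∈c refl)))
zeroInsertions-complete {c = suc x ∷ c} (there z∈) (_ ∷ u) =
  there (∈-map⁺ (suc x ∷_) (zeroInsertions-complete z∈ u))

length-zeroInsertions : ∀ {N} (b : List (Fin N)) → length (zeroInsertions b) ≡ suc (length b)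
length-zeroInsertions []      = refl
length-zeroInsertions (x ∷ b) =
  cong suc (trans (length-map (suc x ∷_) (zeroInsertions b)) (length-zeroInsertions b))

-- What the recurrences need to know about the two notions of block: when two
-- blocks are the same, and how zero is inserted into a block of elements suc x.
-- weight N m is the number of ways to insert zero into one of m blocks with N
-- elements altogether.
record BlockStructure : Set₁ where
  infix 4 _≈_
  field
    _≈_              : ∀ {N} → Rel (List (Fin N)) 0ℓ
    isDecEquivalence : ∀ {N} → IsDecEquivalence (_≈_ {N})
    ≈⇒⊆              : ∀ {N} {b c : List (Fin N)} {x} → b ≈ c → x ∈ b → x ∈ c
    map-suc-cong     : ∀ {N} {b c : List (Fin N)} → b ≈ c → map suc b ≈ map suc c
    strip-cong       : ∀ {N} {b c : List (Fin (suc N))} → b ≈ c → strip b ≈ strip c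

    insertions          : ∀ {N} → List (Fin N) → List (List (Fin (suc N)))
    insertions-↭        : ∀ {N} (b : List (Fin N)) → All (_↭ zero ∷ map suc b) (insertions b)
    insertions-strip    : ∀ {N} (b : List (Fin N)) → All (λ c → strip c ≡ b) (insertions b)
    insertions-distinct : ∀ {N} (b : List (Fin N)) → AllPairs (λ c d → ¬ c ≈ d) (insertions b)
    insertions-cong     : ∀ {N} {b b′ : List (Fin N)} → b ≈ b′ →
                          All (λ c → Any (c ≈_) (insertions b′)) (insertions b)
    insertions-complete : ∀ {N} {c : List (Fin (suc N))} → zero ∈ c → Unique c →
                          Any (c ≈_) (insertions (strip c))

    weight            : ℕ → ℕ → ℕ
    insertions-weight : ∀ {N} (p : List (List (Fin N))) →
                        sum (map (length ∘ insertions) p) ≡ weight (length (concat p)) (length p)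
    length-insertions-[] : ∀ {N} → length (insertions {N} []) ≡ 1

  blocks : ℕ → DecSetoid 0ℓ 0ℓ
  blocks N = record { isDecEquivalence = isDecEquivalence {N} }

setBlocks : BlockStructure
setBlocks = record
  { isDecEquivalence = λ {N} → DecSetoid.isDecEquivalence (finiteSets (Fin.≡-decSetoid N))
  ; ≈⇒⊆                  = λ (b⊆c , _) → b⊆c
  ; map-suc-cong         = λ (b⊆c , c⊆b) → map-suc-mono b⊆c , map-suc-mono c⊆b
  ; strip-cong           = λ {_} {b} {c} (b⊆c , c⊆b) →
      ∈-strip⁺ ∘ b⊆c ∘ ∈-strip⁻ b , ∈-strip⁺ ∘ c⊆b ∘ ∈-strip⁻ c
  -- Every place for zero gives the same set, so one representative suffices and the weight is just
  -- the number of blocks.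
  ; insertions           = λ b → [ zero ∷ map suc b ]
  ; insertions-↭         = λ b → ↭-refl ∷ []
  ; insertions-strip     = λ b → strip-map-suc b ∷ []
  ; insertions-distinct  = λ b → [] ∷ []
  ; insertions-cong      = λ (b⊆c , c⊆b) →
      here (∷-mono (map-suc-mono b⊆c) , ∷-mono (map-suc-mono c⊆b)) ∷ []
  ; insertions-complete  = λ z∈ u → let c↭ = strip-↭ z∈ u in
      here (∈-resp-↭ c↭ , ∈-resp-↭ (↭-sym c↭))
  ; weight               = λ N m → m
  ; insertions-weight    = λ p →
      trans (sum-map-const {c = 1} (All.tabulate {xs = p} λ _ → refl)) (ℕ.*-identityˡ (length p))
  ; length-insertions-[] = refl
  }
  where
  map-suc-mono : ∀ {N} {b c : List (Fin N)} → (∀ {x} → x ∈ b → x ∈ c) →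
                 ∀ {x} → x ∈ map suc b → x ∈ map suc c
  map-suc-mono b⊆c x∈ with ∈-map⁻ suc x∈
  ... | _ , y∈ , refl = ∈-map⁺ suc (b⊆c y∈)

  ∷-mono : ∀ {N} {z : Fin N} {b c : List (Fin N)} → (∀ {x} → x ∈ b → x ∈ c) →
           ∀ {x} → x ∈ z ∷ b → x ∈ z ∷ c
  ∷-mono b⊆c (here eq)  = here eq
  ∷-mono b⊆c (there x∈) = there (b⊆c x∈)

listBlocks : BlockStructure
listBlocks = record
  { isDecEquivalence = λ {N} → DecSetoid.isDecEquivalence (decSetoid (≡-dec (Fin._≟_ {N})))
  ; ≈⇒⊆                  = λ { refl x∈ → x∈ }
  ; map-suc-cong         = cong (map suc)
  ; strip-cong           = cong strip
  ; insertions           = zeroInsertions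
  ; insertions-↭         = zeroInsertions-↭
  ; insertions-strip     = zeroInsertions-strip
  ; insertions-distinct  = zeroInsertions-unique
  ; insertions-cong      = λ { refl → All.tabulate id }
  ; insertions-complete  = zeroInsertions-complete
  -- A block of length l offers l + 1 places, which makes N + m places in m blocks with N elements
  -- altogether.
  ; weight               = ℕ._+_
  ; insertions-weight    = sum-length-zeroInsertions
  ; length-insertions-[] = refl
  }
  where
  open ≡-Reasoning
  sum-length-zeroInsertions : ∀ {N} (p : List (List (Fin N))) →
    sum (map (length ∘ zeroInsertions) p) ≡ length (concat p) ℕ.+ length p
  sum-length-zeroInsertions []      = refl
  sum-length-zeroInsertions (b ∷ p) = begin
    length (zeroInsertions b) ℕ.+ sum (map (length ∘ zeroInsertions) p)
      ≡⟨ cong₂ ℕ._+_ (length-zeroInsertions b) (sum-length-zeroInsertions p) ⟩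
    suc (length b ℕ.+ (length (concat p) ℕ.+ length p))
      ≡⟨ cong suc (ℕ.+-assoc (length b) (length (concat p)) (length p)) ⟨
    suc (length b ℕ.+ length (concat p) ℕ.+ length p)
      ≡⟨ cong (λ l → suc (l ℕ.+ length p)) (length-++ b) ⟨
    suc (length (b ++ concat p) ℕ.+ length p)
      ≡⟨ ℕ.+-suc _ (length p) ⟨
    length (b ++ concat p) ℕ.+ suc (length p) ∎

-- Partitions of the sets Fin (n + r)

concat-↭ : {A : Set} {p q : List (List A)} → p ↭ q → concat p ↭ concat q
concat-↭ _↭_.refl         = ↭-refl
concat-↭ (prep b σ)       = ↭-++⁺ˡ b (concat-↭ σ)
concat-↭ (swap b c σ) =
  ↭-trans (↭-shifts b c) (↭-++⁺ˡ c (↭-++⁺ˡ b (concat-↭ σ)))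
concat-↭ (_↭_.trans σ τ)  = ↭-trans (concat-↭ σ) (concat-↭ τ)

unique-complete-length : ∀ {N} {xs : List (Fin N)} → Unique xs → (∀ x → x ∈ xs) → length xs ≡ N
unique-complete-length {N} xs! x∈xs = trans
  (enumerations-length (setoid (Fin N)) {P = λ _ → ⊤} (enumerates xs! x∈xs)
    (enumerates (Unique.allFin⁺ N) ∈-allFin))
  (length-tabulate id)
  where
  enumerates : ∀ {xs} → Unique xs → (∀ x → x ∈ xs) → Enumerates (setoid (Fin N)) (λ _ → ⊤) xs
  enumerates xs! x∈xs = record
    { sound = All.tabulate λ _ → tt ; distinct = xs! ; complete = λ {x} _ → x∈xs x }

Nonempty : {A : Set} → List A → Set
Nonempty b = 0 < length b

Separated : (n r : ℕ) → List (Fin (n + r)) → Set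
Separated n r b = ∀ (i j : Fin r) → n ↑ʳ i ∈ b → n ↑ʳ j ∈ b → i ≡ j

-- Empty blocks are allowed, because deleting zero from the block that contains nothing else leaves
-- an empty one.
IsLoosePartition : (n r : ℕ) → List (List (Fin (n + r))) → Set
IsLoosePartition n r p =
  Unique (concat p) × (∀ x → x ∈ concat p) × All (Separated n r) p

HasSize : (n r m : ℕ) → List (List (Fin (n + r))) → Set
HasSize n r m p = IsRPartition n r p × length p ≡ m

loose-resp-↭ : ∀ {n r p q} → p ↭ q → IsLoosePartition n r p → IsLoosePartition n r q
loose-resp-↭ σ (p! , x∈p , sep) =
  Unique-resp-↭ (concat-↭ σ) p! , (λ x → ∈-resp-↭ (concat-↭ σ) (x∈p x)) , All-resp-↭ σ sep

hasSize-resp-↭ : ∀ {n r m p q} → p ↭ q → HasSize n r m p → HasSize n r m q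
hasSize-resp-↭ σ ((ne , loose) , len) =
  (All-resp-↭ σ ne , loose-resp-↭ σ loose) , trans (sym (↭-length σ)) len

concat-extend : ∀ {N} {b : List (Fin N)} {c : List (Fin (suc N))} q → c ↭ zero ∷ map suc b →
                concat (c ∷ map (map suc) q) ↭ zero ∷ map suc (concat (b ∷ q))
concat-extend {b = b} q c↭ = ↭-trans (↭-++⁺ʳ _ c↭) (↭-reflexive (cong (zero ∷_)
  (trans (cong (map suc b ++_) (concat-map q)) (sym (map-++ suc b (concat q))))))

separated-suc⁺ : ∀ {n r b} → Separated n r b → Separated (suc n) r (map suc b)
separated-suc⁺ sep i j i∈ j∈ = sep i j (suc∈map-suc⁻ i∈) (suc∈map-suc⁻ j∈)

separated-suc⁻ : ∀ {n r b} → Separated (suc n) r (map suc b) → Separated n r b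
separated-suc⁻ sep i j i∈ j∈ = sep i j (∈-map⁺ suc i∈) (∈-map⁺ suc j∈)

-- Zero is never distinguished, as `suc n ↑ʳ i` reduces to `suc (n ↑ʳ i)`. Separation thus concerns
-- only the entries that `c` shares with `map suc b`.
loose-extend⁺ : ∀ {n r b c q} → c ↭ zero ∷ map suc b →
                IsLoosePartition n r (b ∷ q) → IsLoosePartition (suc n) r (c ∷ map (map suc) q)
loose-extend⁺ {n} {r} {b} {c} {q} c↭ (p! , x∈p , sep-b ∷ sep-q) =
    Unique-resp-↭ (↭-sym σ) (All.map⁺ (All.tabulate λ _ ()) ∷ Unique.map⁺ Fin.suc-injective p!)
  , (λ { zero    → ∈-resp-↭ (↭-sym σ) (here refl)
       ; (suc x) → ∈-resp-↭ (↭-sym σ) (there (∈-map⁺ suc (x∈p x))) })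
  , (λ i j i∈ j∈ → separated-suc⁺ {n} sep-b i j (tail i∈) (tail j∈))
    ∷ All.map⁺ (All.map (separated-suc⁺ {n}) sep-q)
  where
  σ = concat-extend q c↭
  tail : ∀ {x} → suc x ∈ c → suc x ∈ map suc b
  tail x∈ with ∈-resp-↭ c↭ x∈
  ... | there x∈b = x∈b

loose-extend⁻ : ∀ {n r b c q} → c ↭ zero ∷ map suc b →
                IsLoosePartition (suc n) r (c ∷ map (map suc) q) → IsLoosePartition n r (b ∷ q)
loose-extend⁻ {n} {r} {b} {c} {q} c↭ (p! , x∈p , sep-c ∷ sep-q) =
    Unique.map⁻ (AllPairs.tail (Unique-resp-↭ σ p!))
  , x∈
  , (λ i j i∈ j∈ → sep-c i j (into i∈) (into j∈)) ∷ All.map (separated-suc⁻ {n}) (All.map⁻ sep-q)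
  where
  σ = concat-extend q c↭
  x∈ : ∀ x → x ∈ concat (b ∷ q)
  x∈ x with ∈-resp-↭ σ (x∈p (suc x))
  ... | there sx∈ = suc∈map-suc⁻ sx∈
  into : ∀ {x} → x ∈ b → suc x ∈ c
  into x∈b = ∈-resp-↭ (↭-sym c↭) (there (∈-map⁺ suc x∈b))

nonempty-↭ : {A : Set} {x : A} {b c : List A} → c ↭ x ∷ b → Nonempty c
nonempty-↭ c↭ = subst (0 <_) (sym (↭-length c↭)) (s≤s z≤n)

picks : {A : Set} → List A → List (A × List A)
picks []      = []
picks (b ∷ p) = (b , p) ∷ map (λ (c , q) → c , b ∷ q) (picks p)

picks-↭ : {A : Set} (p : List A) → All (λ (b , q) → b ∷ q ↭ p) (picks p)
picks-↭ []      = []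
picks-↭ (b ∷ p) = ↭-refl ∷ All.map⁺ (All.map
  (λ {(c , q)} c∷q↭p → ↭-trans (swap c b ↭-refl) (prep b c∷q↭p)) (picks-↭ p))

map-proj₁-picks : {A : Set} (p : List A) → map proj₁ (picks p) ≡ p
map-proj₁-picks []      = refl
map-proj₁-picks (b ∷ p) =
  cong (b ∷_) (trans (sym (map-∘ (picks p))) (map-proj₁-picks p))

-- For n = 0 every element is distinguished, so two entries of one block would be equal, against
-- uniqueness.
singletons : ∀ {N} (p : List (List (Fin N))) → All Nonempty p → Unique (concat p) →
             All (Separated 0 N) p → p ≡ map [_] (concat p)
singletons []                _       _              _         = refl
singletons ((x ∷ []) ∷ p)    (_ ∷ ne) (_ ∷ u)       (_ ∷ sep) = cong ([ x ] ∷_) (singletons p ne u sep)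
singletons ((x ∷ y ∷ b) ∷ p) _       ((x≢y ∷ _) ∷ _) (s ∷ _)  =
  contradiction (s x y (here refl) (there (here refl))) x≢y

allSingletons-hasSize : ∀ r → HasSize 0 r r (map [_] (allFin r))
allSingletons-hasSize r =
  ( All.map⁺ (All.tabulate λ _ → s≤s z≤n)
  , subst Unique concat≡ (Unique.allFin⁺ r)
  , (λ x → subst (x ∈_) concat≡ (∈-allFin x))
  , All.map⁺ (All.tabulate λ { _ i j (here eq) (here eq′) → trans eq (sym eq′) }) )
  , trans (length-map [_] (allFin r)) (length-tabulate id)
  where
  concat≡ : allFin r ≡ concat (map [_] (allFin r))
  concat≡ = sym (concat-map-[ allFin r ])

-- Correctness of the search for partitions

∈-listsOfLength⁺ : {A : Set} {xs ys : List A} → All (_∈ xs) ys → ys ∈ listsOfLength (length ys) xs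
∈-listsOfLength⁺ []         = here refl
∈-listsOfLength⁺ (y∈ ∷ ys∈) = ∈-cartesianProductWith⁺ _∷_ y∈ (∈-listsOfLength⁺ ys∈)

∈-listsOfLength⁻ : {A : Set} (m : ℕ) {xs ys : List A} → ys ∈ listsOfLength m xs → length ys ≡ m
∈-listsOfLength⁻ zero    (here refl) = refl
∈-listsOfLength⁻ (suc m) {xs} ys∈ with ∈-cartesianProductWith⁻ _∷_ xs _ ys∈
... | _ , _ , _ , zs∈ , refl = cong suc (∈-listsOfLength⁻ m zs∈)

unique-length-≤ : ∀ {N} {b : List (Fin N)} → Unique b → length b ≤ N
unique-length-≤ {N} {b} b! = subst (length b ≤_) (length-tabulate id)
  (length-mono-≤ (setoid (Fin N)) b! (All.tabulate λ {x} _ → ∈-allFin x))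

blocks-unique : {A : Set} (p : List (List A)) → Unique (concat p) → All Unique p
blocks-unique []      _ = []
blocks-unique (b ∷ p) u = Unique-++⁻ˡ b u ∷ blocks-unique p (Unique-++⁻ʳ b u)

-- The search tries blocks of length at most `n + r`; nothing is missed, since a block without
-- repetitions is no longer than that.
∈-rPartitions⁺ : ∀ {r n k p} → HasSize n r (k + r) p → p ∈ rPartitions r n k
∈-rPartitions⁺ {r} {n} {k} {p} (isP@(_ , u , _) , len) = ∈-filter⁺ (isRPartition? n r)
  (subst (λ m → p ∈ blockLists (n + r) m) len (∈-listsOfLength⁺ (All.map
    (λ {b} b! → ∈-concat⁺′ (∈-listsOfLength⁺ (All.tabulate λ {x} _ → ∈-allFin x))
      (∈-map⁺ (λ l → listsOfLength l (allFin (n + r))) (∈-upTo⁺ (s≤s (unique-length-≤ b!)))))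
    (blocks-unique p u))))
  isP

∈-rPartitions⁻ : ∀ {r n k p} → p ∈ rPartitions r n k → HasSize n r (k + r) p
∈-rPartitions⁻ {r} {n} {k} p∈ with ∈-filter⁻ (isRPartition? n r) {xs = blockLists (n + r) (k + r)} p∈
... | p∈′ , isP = isP , ∈-listsOfLength⁻ (k + r) p∈′

-- Enumerating and counting partitions for either notion of block

module _ (B : BlockStructure) where
  open BlockStructure B

  private
    Block : ℕ → Set
    Block N = List (Fin N)

    blockSetoid partitionSetoid : ℕ → Setoid 0ℓ 0ℓ
    blockSetoid N     = DecSetoid.setoid (blocks N)
    partitionSetoid N = DecSetoid.setoid (finiteSets (blocks N))

    module ≈ {N} = Setoid (blockSetoid N)
    module ≋ {N} = Setoid (partitionSetoid N)

    infix 4 _≋_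
    _≋_ : ∀ {N} → Rel (List (Block N)) 0ℓ
    _≋_ = ≋._≈_

  ↭⇒≋ : ∀ {N} {p q : List (Block N)} → p ↭ q → p ≋ q
  ↭⇒≋ σ = Any-resp-↭ σ , Any-resp-↭ (↭-sym σ)

  ∷-cong : ∀ {N} {b c : Block N} {p q} → b ≈ c → p ≋ q → b ∷ p ≋ c ∷ q
  ∷-cong b≈c (p⊆q , q⊆p) =
      (λ { (here x≈) → here (≈.trans x≈ b≈c) ; (there x∈) → there (p⊆q x∈) })
    , (λ { (here x≈) → here (≈.trans x≈ (≈.sym b≈c)) ; (there x∈) → there (q⊆p x∈) })

  -- For equality as sets, heads cancel only if they do not recur in the tails. An entry of `p`
  -- matched with the head `c` would be equivalent to `b`, which `p≉b` excludes.
  drop-∷-⊆ : ∀ {N} {b c : Block N} {p q} → b ≈ c → All (λ d → ¬ d ≈ b) p → b ∷ p ≋ c ∷ q →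
             ∀ {d} → Any (d ≈_) p → Any (d ≈_) q
  drop-∷-⊆ b≈c p≉b (p⊆q , _) d∈p with find d∈p
  ... | e , e∈p , d≈e with p⊆q (there (lose e∈p d≈e))
  ... | here d≈c  = contradiction (≈.trans (≈.sym d≈e) (≈.trans d≈c (≈.sym b≈c))) (All.lookup p≉b e∈p)
  ... | there d∈q = d∈q

  drop-∷ : ∀ {N} {b c : Block N} {p q} → b ≈ c → All (λ d → ¬ d ≈ b) p → All (λ d → ¬ d ≈ c) q →
           b ∷ p ≋ c ∷ q → p ≋ q
  drop-∷ b≈c p≉b q≉c eq = drop-∷-⊆ b≈c p≉b eq , drop-∷-⊆ (≈.sym b≈c) q≉c (≋.sym eq)

  map-suc-≋ : ∀ {N} {p q : List (Block N)} → p ≋ q → map (map suc) p ≋ map (map suc) q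
  map-suc-≋ (p⊆q , q⊆p) = mono p⊆q , mono q⊆p
    where
    mono : ∀ {N} {p q : List (Block N)} → (∀ {d} → Any (d ≈_) p → Any (d ≈_) q) →
           ∀ {d} → Any (d ≈_) (map (map suc) p) → Any (d ≈_) (map (map suc) q)
    mono p⊆q d∈ with find (Any.map⁻ d∈)
    ... | e , e∈p , d≈ =
      Any.map⁺ (Any.map (λ e≈ → ≈.trans d≈ (map-suc-cong e≈)) (p⊆q (lose e∈p ≈.refl)))

  map-strip-≋ : ∀ {N} {p q : List (Block N)} → map (map suc) p ≋ map (map suc) q → p ≋ q
  map-strip-≋ (p⊆q , q⊆p) = mono p⊆q , mono q⊆p
    where
    mono : ∀ {N} {p q : List (Block N)} →
           (∀ {d} → Any (d ≈_) (map (map suc) p) → Any (d ≈_) (map (map suc) q)) →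
           ∀ {d} → Any (d ≈_) p → Any (d ≈_) q
    mono p⊆q {d} d∈ = Any.map
      (λ {e} eq → ≈.trans (≈.reflexive (sym (strip-map-suc d)))
        (≈.trans (strip-cong eq) (≈.reflexive (strip-map-suc e))))
      (Any.map⁻ (p⊆q (Any.map⁺ (Any.map map-suc-cong d∈))))

  map-suc≉ : ∀ {N} {c : Block (suc N)} → zero ∈ c → ∀ q → All (λ d → ¬ d ≈ c) (map (map suc) q)
  map-suc≉ z∈c q = All.map⁺ (All.tabulate λ _ d≈c → zero∉map-suc (≈⇒⊆ (≈.sym d≈c) z∈c))

  -- Equivalent blocks have the same elements and no block of `map (map suc) q′` contains zero, so
  -- `c` can only be matched with `c′`.
  zero-block-≈ : ∀ {N} {c c′ : Block (suc N)} {q q′} → zero ∈ c →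
                 c ∷ map (map suc) q ≋ c′ ∷ map (map suc) q′ → c ≈ c′
  zero-block-≈ {q′ = q′} z∈c (⊆ , _) with ⊆ (here ≈.refl)
  ... | here c≈c′ = c≈c′
  ... | there c∈  = contradiction (Any.map ≈.sym c∈) (All.All¬⇒¬Any (map-suc≉ z∈c q′))

  extend : ∀ {N} → Block N × List (Block N) → List (List (Block (suc N)))
  extend (b , q) = map (_∷ map (map suc) q) (insertions b)

  zero∈insertion : ∀ {N} {b : Block N} {c} → c ∈ insertions b → zero ∈ c
  zero∈insertion {b = b} c∈ =
    ∈-resp-↭ (↭-sym (All.lookup (insertions-↭ b) c∈)) (here refl)

  -- The block with zero is recognisable: stripping it recovers the marked block, and cancelling it
  -- recovers the others.
  extend-reflects : ∀ {N} {x x′ : Block N × List (Block N)} {y y′} → y ∈ extend x → y′ ∈ extend x′ →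
                    y ≋ y′ → (proj₁ x ≈ proj₁ x′) × (proj₂ x ≋ proj₂ x′)
  extend-reflects {x = b , q} {b′ , q′} y∈ y′∈ y≋y′
    with ∈-map⁻ _ y∈ | ∈-map⁻ _ y′∈
  ... | c , c∈ , refl | c′ , c′∈ , refl =
      ≈.trans (≈.reflexive (sym (All.lookup (insertions-strip b) c∈)))
        (≈.trans (strip-cong c≈c′) (≈.reflexive (All.lookup (insertions-strip b′) c′∈)))
    , map-strip-≋ (drop-∷ c≈c′ (map-suc≉ (zero∈insertion c∈) q) (map-suc≉ (zero∈insertion c′∈) q′) y≋y′)
    where
    c≈c′ : c ≈ c′
    c≈c′ = zero-block-≈ {q = q} {q′ = q′} (zero∈insertion c∈) y≋y′

  -- Equivalent blocks would share an element, which would then occur twice in the concatenation.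
  -- Nonemptiness provides that element: two empty blocks would go unnoticed.
  blocks-distinct : ∀ {N} {p : List (Block N)} → All Nonempty p → Unique (concat p) →
                    AllPairs (λ b c → ¬ b ≈ c) p
  blocks-distinct {p = []} _ _ = []
  blocks-distinct {p = (x ∷ b) ∷ p} (_ ∷ ne) u =
    All.tabulate (λ c∈p b≈c → Unique-++⇒disjoint {xs = x ∷ b} u (here refl)
      (∈-concat⁺′ (≈⇒⊆ b≈c (here refl)) c∈p))
    ∷ blocks-distinct ne (Unique-++⁻ʳ (x ∷ b) u)

  module _ (n r m : ℕ) where

    -- Deleting zero from a partition of Fin (suc n + r) leaves the block b in
    -- which it was, together with the other blocks q. Either zero was alone in
    -- its block or b is still nonempty.
    MarkedEmpty MarkedNonempty : Block (n + r) × List (Block (n + r)) → Set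
    MarkedEmpty    (b , q) = b ≡ [] × HasSize n r m q
    MarkedNonempty (b , q) = HasSize n r (suc m) (b ∷ q)

    private
      markedSetoid : Setoid 0ℓ 0ℓ
      markedSetoid = blockSetoid (n + r) ×ₛ partitionSetoid (n + r)

      markEmpty : List (Block (n + r)) → List (Block (n + r) × List (Block (n + r)))
      markEmpty q = [ ([] , q) ]

    enumerates-markedEmpty : ∀ {ps} → Enumerates (partitionSetoid (n + r)) (HasSize n r m) ps →
                             Enumerates markedSetoid MarkedEmpty (concatMap markEmpty ps)
    enumerates-markedEmpty = Enumerates-concatMap (partitionSetoid (n + r)) markedSetoid markEmpty
      (λ size → (refl , size) ∷ [])
      (λ _ → [] ∷ [])
      (λ { (here refl) (here refl) (_ , q≋q′) → q≋q′ })
      (λ { {_ , q} (refl , size) → q , size , λ _ q≋q′ → here (≈.refl , q≋q′) })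

    others≉ : ∀ {b q} → HasSize n r (suc m) (b ∷ q) → All (λ d → ¬ d ≈ b) q
    others≉ ((ne , u , _) , _) =
      All.map (λ b≉d d≈b → b≉d (≈.sym d≈b)) (AllPairs.head (blocks-distinct ne u))

    enumerates-markedNonempty :
      ∀ {ps} → Enumerates (partitionSetoid (n + r)) (HasSize n r (suc m)) ps →
      Enumerates markedSetoid MarkedNonempty (concatMap picks ps)
    enumerates-markedNonempty = Enumerates-concatMap (partitionSetoid (n + r)) markedSetoid picks
      (λ {p} size → All.map (λ σ → hasSize-resp-↭ (↭-sym σ) size) (picks-↭ p))
      -- The marked blocks alone already tell the choices apart.
      (λ {p} ((ne , u , _) , _) → AllPairs.map (λ b≉c eq → b≉c (proj₁ eq)) (AllPairs.map⁻
        (subst (AllPairs (λ b c → ¬ b ≈ c)) (sym (map-proj₁-picks p)) (blocks-distinct ne u))))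
      -- Putting the marked block back restores the partition up to order.
      (λ {p} {p′} x∈ x′∈ (b≈b′ , q≋q′) →
        ≋.trans (↭⇒≋ (↭-sym (All.lookup (picks-↭ p) x∈)))
          (≋.trans (∷-cong b≈b′ q≋q′) (↭⇒≋ (All.lookup (picks-↭ p′) x′∈))))
      (λ {x} size → proj₁ x ∷ proj₂ x , size , λ size′ → pick size size′)
      where
      pick : ∀ {b q p} → HasSize n r (suc m) (b ∷ q) → HasSize n r (suc m) p → b ∷ q ≋ p →
             Any (λ x → (b ≈ proj₁ x) × (q ≋ proj₂ x)) (picks p)
      pick {b} {p = p} size size′ eq
        with find (Any.map⁻ (subst (Any (b ≈_)) (sym (map-proj₁-picks p)) (proj₁ eq (here ≈.refl))))
      ... | _ , x∈ , b≈b′ = lose x∈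
        ( b≈b′
        , drop-∷ b≈b′ (others≉ size) (others≉ (hasSize-resp-↭ (↭-sym σ) size′))
            (≋.trans eq (↭⇒≋ (↭-sym σ))) )
        where σ = All.lookup (picks-↭ p) x∈

    marked-properties : ∀ {b q} → (MarkedEmpty ∪ MarkedNonempty) (b , q) →
                        All Nonempty q × IsLoosePartition n r (b ∷ q) × length q ≡ m
    marked-properties (inj₁ (refl , (ne , u , x∈ , sep) , len)) =
      ne , (u , x∈ , (λ _ _ ()) ∷ sep) , len
    marked-properties (inj₂ ((_ ∷ ne , loose) , len)) = ne , loose , ℕ.suc-injective len

    marked-intro : ∀ {b q} → All Nonempty q → IsLoosePartition n r (b ∷ q) → length q ≡ m →
                   (MarkedEmpty ∪ MarkedNonempty) (b , q)
    marked-intro {[]}    ne (u , x∈ , _ ∷ sep) len = inj₁ (refl , (ne , u , x∈ , sep) , len)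
    marked-intro {x ∷ b} ne loose              len = inj₂ ((s≤s z≤n ∷ ne , loose) , cong suc len)

    enumerates-extend :
      ∀ {xs} → Enumerates markedSetoid (MarkedEmpty ∪ MarkedNonempty) xs →
      Enumerates (partitionSetoid (suc n + r)) (HasSize (suc n) r (suc m)) (concatMap extend xs)
    enumerates-extend = Enumerates-concatMap markedSetoid (partitionSetoid (suc n + r)) extend
      (λ {(b , q)} marked → let ne , loose , len = marked-properties marked in
        All.map⁺ (All.map (λ {c} c↭ →
            ( (nonempty-↭ c↭ ∷ All.map⁺ (All.map (λ {d} → subst (0 <_) (sym (length-map suc d))) ne))
            , loose-extend⁺ c↭ loose )
          , cong suc (trans (length-map (map suc) q) len))
          (insertions-↭ b)))
      (λ {(b , q)} _ → AllPairs.map⁺ (distinct q (All.tabulate zero∈insertion) (insertions-distinct b)))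
      extend-reflects
      complete
      where
      distinct : ∀ q {cs : List (Block (suc n + r))} → All (zero ∈_) cs → AllPairs (λ c d → ¬ c ≈ d) cs →
                 AllPairs (λ c d → ¬ (c ∷ map (map suc) q ≋ d ∷ map (map suc) q)) cs
      distinct q []         []           = []
      distinct q (z∈ ∷ z∈s) (c≉ ∷ cs!) =
        All.map (λ c≉d eq → c≉d (zero-block-≈ {q = q} {q′ = q} z∈ eq)) c≉ ∷ distinct q z∈s cs!

      complete : ∀ {y} → HasSize (suc n) r (suc m) y →
        ∃ λ x → (MarkedEmpty ∪ MarkedNonempty) x ×
          (∀ {x′} → (MarkedEmpty ∪ MarkedNonempty) x′ → (proj₁ x ≈ proj₁ x′) × (proj₂ x ≋ proj₂ x′) →
            Any (y ≋_) (extend x′))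
      complete {y} size@((_ , _ , x∈y , _) , _) with ∈-concat⁻′ y (x∈y zero)
      ... | c , z∈c , c∈y with ∈-∃++ c∈y
      ... | ys , zs , refl with hasSize-resp-↭ (shift c ys zs) size
      ... | ((_ ∷ ne) , loose@(u , _ , _)) , len =
        -- `c` is the block with zero, moved to the front by `shift`. By disjointness the other
        -- blocks lack zero, so stripping them only undoes `suc`.
        (strip c , map strip (ys ++ zs)) , marked-intro
          (All.map (λ {d} → subst (0 <_) (length-map suc d))
            (All.map⁻ (subst (All Nonempty) (sym rest≡) ne)))
          (loose-extend⁻ c↭ (subst (λ q → IsLoosePartition (suc n) r (c ∷ q)) (sym rest≡) loose))
          (trans (length-map strip (ys ++ zs)) (ℕ.suc-injective len))
        -- The listed pair is only equivalent to the stripped one, so the insertion that gives back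
        -- `c` is carried over from `strip c` to `b′`.
        , λ { {b′ , q′} _ (b≈b′ , q≋q′) →
            let d , d∈ , c≈d = find (insertions-complete z∈c c!)
                d′ , d′∈ , d≈d′ = find (All.lookup (insertions-cong b≈b′) d∈)
            in Any.map⁺ (lose d′∈ (≋.trans (↭⇒≋ (shift c ys zs))
                 (∷-cong (≈.trans c≈d d≈d′) (≋.trans (≋.reflexive (sym rest≡)) (map-suc-≋ q≋q′))))) }
        where
        c! : Unique c
        c! = Unique-++⁻ˡ c u
        c↭ : c ↭ zero ∷ map suc (strip c)
        c↭ = strip-↭ z∈c c!
        map-suc-strip-all : ∀ {q : List (Block (suc n + r))} → All (zero ∉_) q →
                            map (map suc) (map strip q) ≡ q
        map-suc-strip-all []         = refl
        map-suc-strip-all (z∉ ∷ z∉s) = cong₂ _∷_ (map-suc-strip z∉) (map-suc-strip-all z∉s)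
        rest≡ : map (map suc) (map strip (ys ++ zs)) ≡ ys ++ zs
        rest≡ = map-suc-strip-all (All.tabulate λ d∈ z∈d →
          Unique-++⇒disjoint u z∈c (∈-concat⁺′ z∈d d∈))

  -- m is the number of all blocks, which is k + r in the notation of rPartitions.
  count : ℕ → ℕ → ℕ → ℕ
  count r zero    m       = if does (m ℕ.≟ r) then 1 else 0
  count r (suc n) zero    = 0
  count r (suc n) (suc m) = count r n m ℕ.+ weight (n + r) (suc m) ℕ.* count r n (suc m)

  loose-length : ∀ {n r p} → IsLoosePartition n r p → length (concat p) ≡ n + r
  loose-length (p! , x∈p , _) = unique-complete-length p! x∈p

  singletons-≋ : ∀ {r m p} → HasSize 0 r m p → p ≋ map [_] (allFin r)
  singletons-≋ {r} {p = p} ((ne , u , x∈p , sep) , _) =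
    subst (_≋ map [_] (allFin r)) (sym (singletons p ne u sep))
      (mono (λ _ → ∈-allFin _) , mono (λ _ → x∈p _))
    where
    mono : ∀ {xs ys : List (Fin r)} → (∀ {x} → x ∈ xs → x ∈ ys) →
           ∀ {d} → Any (d ≈_) (map [_] xs) → Any (d ≈_) (map [_] ys)
    mono xs⊆ys d∈ with find (Any.map⁻ d∈)
    ... | _ , x∈xs , d≈ = Any.map⁺ (lose (xs⊆ys x∈xs) d≈)

  base-size : ∀ {r m p} → HasSize 0 r m p → m ≡ r
  base-size {r} {m} {p} ((ne , loose@(u , _ , sep)) , len) = begin
    m                              ≡⟨ len ⟨
    length p                       ≡⟨ cong length (singletons p ne u sep) ⟩
    length (map [_] (concat p))    ≡⟨ length-map [_] (concat p) ⟩
    length (concat p)              ≡⟨ loose-length {0} loose ⟩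
    r                              ∎
    where open ≡-Reasoning

  -- An empty marked block admits one insertion. For a partition in `qs`, the insertions into all
  -- its possible marked blocks add up to the weight, which depends only on the numbers of elements
  -- and blocks.
  length-extend-marked : ∀ {n r m ps qs} → All (HasSize n r (suc m)) qs →
    length (concatMap (extend {n + r}) (concatMap (λ q → [ ([] , q) ]) ps ++ concatMap picks qs)) ≡
    length ps ℕ.+ weight (n + r) (suc m) ℕ.* length qs
  length-extend-marked {n} {r} {m} {ps} {qs} sizes = begin
    length (concatMap extend (concatMap markEmpty ps ++ concatMap picks qs))
      ≡⟨ cong length (concatMap-++ extend (concatMap markEmpty ps) (concatMap picks qs)) ⟩
    length (concatMap extend (concatMap markEmpty ps) ++ concatMap extend (concatMap picks qs))
      ≡⟨ length-++ (concatMap extend (concatMap markEmpty ps)) ⟩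
    length (concatMap extend (concatMap markEmpty ps)) ℕ.+ length (concatMap extend (concatMap picks qs))
      ≡⟨ cong₂ ℕ._+_ (counts {w = 1} markEmpty (All.tabulate {xs = ps} λ _ →
           trans (ℕ.+-identityʳ _) length-insertions-[]))
         (counts picks (All.map pick-weight sizes)) ⟩
    1 ℕ.* length ps ℕ.+ weight (n + r) (suc m) ℕ.* length qs
      ≡⟨ cong (ℕ._+ _) (ℕ.*-identityˡ (length ps)) ⟩
    length ps ℕ.+ weight (n + r) (suc m) ℕ.* length qs ∎
    where
    open ≡-Reasoning
    markEmpty : List (Block (n + r)) → List (Block (n + r) × List (Block (n + r)))
    markEmpty q = [ ([] , q) ]

    counts : ∀ {w} {ps : List (List (Block (n + r)))}
             (f : List (Block (n + r)) → List (Block (n + r) × List (Block (n + r)))) →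
             All (λ p → sum (map (length ∘ insertions ∘ proj₁) (f p)) ≡ w) ps →
             length (concatMap extend (concatMap f ps)) ≡ w ℕ.* length ps
    counts {ps = ps} f eqs = trans (cong length (concatMap-concatMap extend f ps))
      (trans (length-concatMap (concatMap extend ∘ f) ps)
        (sum-map-const (All.map (λ {p} eq → trans (length-concatMap extend (f p))
          (trans (cong sum (map-cong (λ (b , q) → length-map _ (insertions b)) (f p))) eq)) eqs)))

    pick-weight : ∀ {p} → HasSize n r (suc m) p →
                  sum (map (length ∘ insertions ∘ proj₁) (picks p)) ≡ weight (n + r) (suc m)
    pick-weight {p} ((_ , loose) , len) = begin
      sum (map (length ∘ insertions ∘ proj₁) (picks p))
        ≡⟨ cong sum (map-∘ (picks p)) ⟩
      sum (map (length ∘ insertions) (map proj₁ (picks p)))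
        ≡⟨ cong (sum ∘ map (length ∘ insertions)) (map-proj₁-picks p) ⟩
      sum (map (length ∘ insertions) p)
        ≡⟨ insertions-weight p ⟩
      weight (length (concat p)) (length p)
        ≡⟨ cong₂ weight (loose-length {n} loose) len ⟩
      weight (n + r) (suc m) ∎

  enumeration : ∀ r n m → ∃ λ ps →
    Enumerates (partitionSetoid (n + r)) (HasSize n r m) ps × length ps ≡ count r n m
  enumeration r zero m with m ℕ.≟ r
  ... | yes refl = _ , Enumerates-singleton _ (allSingletons-hasSize r) singletons-≋
    , cong (if_then 1 else 0) (sym (dec-true (m ℕ.≟ r) refl))
  ... | no  m≢r  = _ , Enumerates-empty _ (m≢r ∘ base-size)
    , cong (if_then 1 else 0) (sym (dec-false (m ℕ.≟ r) m≢r))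
  enumeration r (suc n) zero =
    _ , Enumerates-empty _ (λ { {[]} ((_ , _ , x∈p , _) , _) → nowhere (x∈p zero) }) , refl
    where
    nowhere : ∀ {x : Fin (suc n + r)} → x ∉ []
    nowhere ()
  enumeration r (suc n) (suc m) with enumeration r n m | enumeration r n (suc m)
  ... | ps , eps , ∣ps∣ | qs , eqs , ∣qs∣ =
    _ , enumerates-extend n r m (Enumerates-++ _ empty≉
          (enumerates-markedEmpty n r m eps) (enumerates-markedNonempty n r m eqs))
      , trans (length-extend-marked {n} {ps = ps} (Enumerates.sound eqs))
              (cong₂ (λ a b → a ℕ.+ weight (n + r) (suc m) ℕ.* b) ∣ps∣ ∣qs∣)
    where
    empty≉ : ∀ {x y} → MarkedEmpty n r m x → MarkedNonempty n r m y →
             ¬ ((proj₁ x ≈ proj₁ y) × (proj₂ x ≋ proj₂ y))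
    empty≉ {y = z ∷ _ , _} (refl , _) _ (eq , _) with ≈⇒⊆ (≈.sym eq) (here refl)
    ... | ()
    empty≉ {y = [] , _} _ ((() ∷ _ , _) , _)

  numberOf-rPartitions : ∀ r n k →
    numberOf (finiteSets (blocks (n + r))) (rPartitions r n k) ≡ count r n (k + r)
  numberOf-rPartitions r n k with enumeration r n (k + r)
  ... | ps , eps , ∣ps∣ = trans
    (numberOf-enumerated (finiteSets (blocks (n + r)))
      (All.tabulate ∈-rPartitions⁻) ∈-rPartitions⁺ eps) ∣ps∣

  count-< : ∀ {r} n {m} → m < r → count r n m ≡ 0
  count-< {r} zero    {m}     m<r = cong (if_then 1 else 0) (dec-false (m ℕ.≟ r) (ℕ.<⇒≢ m<r))
  count-<     (suc n) {zero}  m<r = refl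
  count-< {r} (suc n) {suc m} m<r = cong₂ ℕ._+_ (count-< n (ℕ.<-trans (ℕ.n<1+n m) m<r))
    (trans (cong (weight (n + r) (suc m) ℕ.*_) (count-< n m<r)) (ℕ.*-zeroʳ (weight (n + r) (suc m))))

  -- For positive `r` the recurrence also calls on the count with `r` minus one blocks, which
  -- `count-<` makes 0: too few blocks to separate the distinguished elements.
  count-suc-r : ∀ r n → count r (suc n) r ≡ weight (n + r) r ℕ.* count r n r
  -- The left side is 0 by definition; summing insertions over the empty partition shows that
  -- `weight 0 0` is 0 as well.
  count-suc-r zero    zero    = cong (ℕ._* 1) (insertions-weight {0} [])
  count-suc-r zero    (suc n) = sym (ℕ.*-zeroʳ (weight (suc n + 0) 0))
  count-suc-r (suc r) n       =
    cong (ℕ._+ weight (n + suc r) (suc r) ℕ.* count (suc r) n (suc r)) (count-< n (ℕ.n<1+n r))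

-- The recurrence

record Triangle (w a : ℕ → ℕ → ℕ) : Set where
  field
    top     : a 0 0 ≡ 1
    top-suc : ∀ k → a 0 (suc k) ≡ 0
    edge    : ∀ n → a (suc n) 0 ≡ w n 0 ℕ.* a n 0
    inner   : ∀ n k → a (suc n) (suc k) ≡ a n k ℕ.+ w n (suc k) ℕ.* a n (suc k)

  vanish : ∀ {n k} → n < k → a n k ≡ 0
  vanish {zero}  {suc k} _         = top-suc k
  vanish {suc n} {suc k} (s≤s n<k) = trans (inner n k) (cong₂ ℕ._+_ (vanish n<k)
    (trans (cong (w n (suc k) ℕ.*_) (vanish (ℕ.m≤n⇒m≤1+n n<k))) (ℕ.*-zeroʳ (w n (suc k)))))

rPartitions-triangle : (B : BlockStructure) (r : ℕ) → let open BlockStructure B in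
  Triangle (λ n k → weight (n + r) (k + r))
           (λ n k → numberOf (finiteSets (blocks (n + r))) (rPartitions r n k))
rPartitions-triangle B r = record
  { top     = trans (number 0 0) (cong (if_then 1 else 0) (dec-true (r ℕ.≟ r) refl))
  ; top-suc = λ k → trans (number 0 (suc k))
      (cong (if_then 1 else 0) (dec-false (suc k + r ℕ.≟ r) (ℕ.m≢1+n+m r ∘ sym)))
  ; edge    = λ n → trans (number (suc n) 0) (trans (count-suc-r B r n)
      (cong (weight (n + r) r ℕ.*_) (sym (number n 0))))
  ; inner   = λ n k → trans (number (suc n) (suc k)) (sym (cong₂ ℕ._+_ (number n k)
      (cong (weight (n + r) (suc k + r) ℕ.*_) (number n (suc k)))))
  }
  where
  open BlockStructure B
  number : ∀ n k → numberOf (finiteSets (blocks (n + r))) (rPartitions r n k) ≡ count B r n (k + r)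
  number = numberOf-rPartitions B r

-- Finite sums of integers

Σ< : ℕ → (ℕ → ℤ) → ℤ
Σ< zero    f = 0ℤ
Σ< (suc n) f = f 0 ℤ.+ Σ< n (f ∘ suc)

∑ℤ≤-Σ< : ∀ n f → ∑ℤ≤ n f ≡ Σ< (suc n) f
∑ℤ≤-Σ< n f = trans (cong (foldr ℤ._+_ 0ℤ) (map-upTo f (suc n))) (go (suc n) f)
  where
  go : ∀ n f → foldr ℤ._+_ 0ℤ (applyUpTo f n) ≡ Σ< n f
  go zero    f = refl
  go (suc n) f = cong (λ z → f 0 ℤ.+ z) (go n (f ∘ suc))

∑≤-Σ< : ∀ n f → + ∑≤ n f ≡ Σ< (suc n) (λ k → + f k)
∑≤-Σ< n f = trans (cong (λ xs → + sum xs) (map-upTo f (suc n))) (go (suc n) f)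
  where
  go : ∀ n f → + sum (applyUpTo f n) ≡ Σ< n (λ k → + f k)
  go zero    f = refl
  go (suc n) f = cong (λ z → + f 0 ℤ.+ z) (go n (f ∘ suc))

Σ<-cong : ∀ n {f g} → (∀ {k} → k < n → f k ≡ g k) → Σ< n f ≡ Σ< n g
Σ<-cong zero    f≗g = refl
Σ<-cong (suc n) f≗g = cong₂ ℤ._+_ (f≗g (s≤s z≤n)) (Σ<-cong n (f≗g ∘ s≤s))

Σ<-0 : ∀ n → Σ< n (λ _ → 0ℤ) ≡ 0ℤ
Σ<-0 zero    = refl
Σ<-0 (suc n) = trans (ℤ.+-identityˡ _) (Σ<-0 n)

Σ<-+ : ∀ n f g → Σ< n (λ k → f k ℤ.+ g k) ≡ Σ< n f ℤ.+ Σ< n g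
Σ<-+ zero    f g = refl
Σ<-+ (suc n) f g = trans (cong (λ z → f 0 ℤ.+ g 0 ℤ.+ z) (Σ<-+ n (f ∘ suc) (g ∘ suc)))
  (interchange (f 0) (g 0) (Σ< n (f ∘ suc)) (Σ< n (g ∘ suc)))
  where
  interchange : ∀ a b c d → a ℤ.+ b ℤ.+ (c ℤ.+ d) ≡ a ℤ.+ c ℤ.+ (b ℤ.+ d)
  interchange = solve-∀

Σ<-*ˡ : ∀ n c f → Σ< n (λ k → c * f k) ≡ c * Σ< n f
Σ<-*ˡ zero    c f = sym (ℤ.*-zeroʳ c)
Σ<-*ˡ (suc n) c f =
  trans (cong (λ z → c * f 0 ℤ.+ z) (Σ<-*ˡ n c (f ∘ suc)))
        (sym (ℤ.*-distribˡ-+ c (f 0) (Σ< n (f ∘ suc))))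

Σ<-extend : ∀ {m n} f → m ≤ n → (∀ {k} → m ≤ k → f k ≡ 0ℤ) → Σ< m f ≡ Σ< n f
Σ<-extend {zero}  {n}     f m≤n       f≗0 = sym (trans (Σ<-cong n (λ _ → f≗0 z≤n)) (Σ<-0 n))
Σ<-extend {suc m} {suc n} f (s≤s m≤n) f≗0 = cong (λ z → f 0 ℤ.+ z) (Σ<-extend (f ∘ suc) m≤n (f≗0 ∘ s≤s))

Σ<-swap : ∀ m n (f : ℕ → ℕ → ℤ) → Σ< m (λ i → Σ< n (f i)) ≡ Σ< n (λ j → Σ< m (λ i → f i j))
Σ<-swap zero    n f = sym (Σ<-0 n)
Σ<-swap (suc m) n f = trans (cong (λ z → Σ< n (f 0) ℤ.+ z) (Σ<-swap m n (f ∘ suc)))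
  (sym (Σ<-+ n (f 0) (λ j → Σ< m (λ i → f (suc i) j))))

-- Inversion

module _ (r : ℕ) {S L : ℕ → ℕ → ℕ}
         (S-triangle : Triangle (λ n k → k + r) S)
         (L-triangle : Triangle (λ n k → n + r + (k + r)) L) where
  private
    module S = Triangle S-triangle
    module L = Triangle L-triangle
  open ≡-Reasoning

  -- Beyond the diagonal the truncated exponent is 0, but there the factor `S n k` vanishes.
  signed : ℕ → ℕ → ℤ
  signed n k = -1ℤ ^ (n ∸ k) * + S n k

  signed-vanish : ∀ {n k} → n < k → signed n k ≡ 0ℤ
  signed-vanish {n} {k} n<k =
    trans (cong (λ s → -1ℤ ^ (n ∸ k) * + s) (S.vanish n<k)) (ℤ.*-zeroʳ (-1ℤ ^ (n ∸ k)))

  private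
    rearrange : ∀ x y z → -1ℤ * x * (y * z) ≡ ℤ.- y * (x * z)
    rearrange = solve-∀

  signed-edge : ∀ n → signed (suc n) 0 ≡ ℤ.- + r * signed n 0
  signed-edge n = begin
    -1ℤ * -1ℤ ^ n * + S (suc n) 0     ≡⟨ cong (λ s → -1ℤ * -1ℤ ^ n * s)
                                           (trans (cong +_ (S.edge n)) (ℤ.pos-* r (S n 0))) ⟩
    -1ℤ * -1ℤ ^ n * (+ r * + S n 0)   ≡⟨ rearrange (-1ℤ ^ n) (+ r) (+ S n 0) ⟩
    ℤ.- + r * (-1ℤ ^ n * + S n 0)     ∎

  signed-inner : ∀ n k → signed (suc n) (suc k) ≡
                 signed n k ℤ.+ ℤ.- + (suc k + r) * signed n (suc k)
  signed-inner n k = begin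
    -1ℤ ^ (n ∸ k) * + S (suc n) (suc k)
      ≡⟨ cong (-1ℤ ^ (n ∸ k) *_) (trans (cong +_ (S.inner n k))
           (cong (λ z → + S n k ℤ.+ z) (ℤ.pos-* (suc k + r) (S n (suc k))))) ⟩
    -1ℤ ^ (n ∸ k) * (+ S n k ℤ.+ + (suc k + r) * + S n (suc k))
      ≡⟨ ℤ.*-distribˡ-+ (-1ℤ ^ (n ∸ k)) (+ S n k) _ ⟩
    signed n k ℤ.+ -1ℤ ^ (n ∸ k) * (+ (suc k + r) * + S n (suc k))
      ≡⟨ cong (λ z → signed n k ℤ.+ z) (sign-change (k ℕ.<? n)) ⟩
    signed n k ℤ.+ ℤ.- + (suc k + r) * signed n (suc k) ∎
    where
    -- Lowering the exponent by one flips the sign only while `k < n`. Otherwise truncated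
    -- subtraction gives 0 for both exponents, and the identity survives because `S n (suc k)` is 0.
    sign-change : Dec (k < n) → -1ℤ ^ (n ∸ k) * (+ (suc k + r) * + S n (suc k)) ≡
                                ℤ.- + (suc k + r) * signed n (suc k)
    sign-change (yes k<n) = begin
      -1ℤ ^ (n ∸ k) * (+ (suc k + r) * + S n (suc k))
        ≡⟨ cong (λ e → -1ℤ ^ e * (+ (suc k + r) * + S n (suc k))) (ℕ.+-∸-assoc 1 k<n) ⟩
      -1ℤ * -1ℤ ^ (n ∸ suc k) * (+ (suc k + r) * + S n (suc k))
        ≡⟨ rearrange (-1ℤ ^ (n ∸ suc k)) (+ (suc k + r)) (+ S n (suc k)) ⟩
      ℤ.- + (suc k + r) * signed n (suc k) ∎
    sign-change (no k≮n) = begin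
      -1ℤ ^ (n ∸ k) * (+ (suc k + r) * + S n (suc k))
        ≡⟨ cong (λ s → -1ℤ ^ (n ∸ k) * (+ (suc k + r) * + s)) (S.vanish n<1+k) ⟩
      -1ℤ ^ (n ∸ k) * (+ (suc k + r) * 0ℤ)
        ≡⟨ cong (-1ℤ ^ (n ∸ k) *_) (ℤ.*-zeroʳ (+ (suc k + r))) ⟩
      -1ℤ ^ (n ∸ k) * 0ℤ
        ≡⟨ ℤ.*-zeroʳ (-1ℤ ^ (n ∸ k)) ⟩
      0ℤ
        ≡⟨ ℤ.*-zeroʳ (ℤ.- + (suc k + r)) ⟨
      ℤ.- + (suc k + r) * 0ℤ
        ≡⟨ cong (ℤ.- + (suc k + r) *_) (signed-vanish n<1+k) ⟨
      ℤ.- + (suc k + r) * signed n (suc k) ∎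
      where
      n<1+k : n < suc k
      n<1+k = s≤s (ℕ.≮⇒≥ k≮n)

  -- Summation by parts: the recurrence of S is moved onto f.
  signed-sum-suc : ∀ n (f : ℕ → ℤ) → Σ< (suc (suc n)) (λ k → signed (suc n) k * f k) ≡
                   Σ< (suc n) (λ k → signed n k * (f (suc k) ℤ.- + (k + r) * f k))
  signed-sum-suc n f = begin
    signed (suc n) 0 * f 0 ℤ.+ Σ< (suc n) (λ k → signed (suc n) (suc k) * f (suc k))
      ≡⟨ cong₂ ℤ._+_ (cong (_* f 0) (signed-edge n)) (Σ<-cong (suc n) λ {k} _ →
           trans (cong (_* f (suc k)) (signed-inner n k))
                 (ℤ.*-distribʳ-+ (f (suc k)) (signed n k) (ℤ.- + (suc k + r) * signed n (suc k)))) ⟩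
    g 0 ℤ.+ Σ< (suc n) (λ k → h k ℤ.+ g (suc k))
      ≡⟨ cong (λ z → g 0 ℤ.+ z) (Σ<-+ (suc n) h (g ∘ suc)) ⟩
    g 0 ℤ.+ (Σ< (suc n) h ℤ.+ Σ< (suc n) (g ∘ suc))
      ≡⟨ exchange (g 0) (Σ< (suc n) h) (Σ< (suc n) (g ∘ suc)) ⟩
    Σ< (suc n) h ℤ.+ Σ< (suc (suc n)) g
      -- The surplus term has index `suc n`, where `signed n` is 0.
      ≡⟨ cong (λ z → Σ< (suc n) h ℤ.+ z) (Σ<-extend g (ℕ.n≤1+n (suc n)) g-vanish) ⟨
    Σ< (suc n) h ℤ.+ Σ< (suc n) g
      ≡⟨ Σ<-+ (suc n) h g ⟨
    Σ< (suc n) (λ k → h k ℤ.+ g k)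
      ≡⟨ Σ<-cong (suc n) (λ {k} _ → collect (signed n k) (f (suc k)) (+ (k + r)) (f k)) ⟩
    Σ< (suc n) (λ k → signed n k * (f (suc k) ℤ.- + (k + r) * f k)) ∎
    where
    g h : ℕ → ℤ
    g k = ℤ.- + (k + r) * signed n k * f k
    h k = signed n k * f (suc k)

    g-vanish : ∀ {k} → n < k → g k ≡ 0ℤ
    g-vanish {k} n<k = cong (_* f k) (trans (cong (ℤ.- + (k + r) *_) (signed-vanish n<k))
                                            (ℤ.*-zeroʳ (ℤ.- + (k + r))))
    exchange : ∀ a b c → a ℤ.+ (b ℤ.+ c) ≡ b ℤ.+ (a ℤ.+ c)
    exchange = solve-∀
    collect : ∀ s f′ c f → s * f′ ℤ.+ ℤ.- c * s * f ≡ s * (f′ ℤ.- c * f)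
    collect = solve-∀

  L-edge-difference : ∀ k → + L (suc k) 0 ℤ.- + (k + r) * + L k 0 ≡ + r * + L k 0
  L-edge-difference k = begin
    + L (suc k) 0 ℤ.- + (k + r) * + L k 0
      ≡⟨ cong (ℤ._- + (k + r) * + L k 0) (trans (cong +_ (L.edge k)) (ℤ.pos-* (k + r + r) (L k 0))) ⟩
    (+ (k + r) ℤ.+ + r) * + L k 0 ℤ.- + (k + r) * + L k 0
      ≡⟨ cancel (+ (k + r)) (+ r) (+ L k 0) ⟩
    + r * + L k 0 ∎
    where
    cancel : ∀ a b x → (a ℤ.+ b) * x ℤ.- a * x ≡ b * x
    cancel = solve-∀

  L-inner-difference : ∀ k j → + L (suc k) (suc j) ℤ.- + (k + r) * + L k (suc j) ≡
                       + L k j ℤ.+ + (suc j + r) * + L k (suc j)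
  L-inner-difference k j = begin
    + L (suc k) (suc j) ℤ.- + (k + r) * + L k (suc j)
      ≡⟨ cong (ℤ._- + (k + r) * + L k (suc j)) (trans (cong +_ (L.inner k j))
           (cong (λ z → + L k j ℤ.+ z) (ℤ.pos-* (k + r + (suc j + r)) (L k (suc j))))) ⟩
    + L k j ℤ.+ (+ (k + r) ℤ.+ + (suc j + r)) * + L k (suc j) ℤ.- + (k + r) * + L k (suc j)
      ≡⟨ cancel (+ L k j) (+ (k + r)) (+ (suc j + r)) (+ L k (suc j)) ⟩
    + L k j ℤ.+ + (suc j + r) * + L k (suc j) ∎
    where
    cancel : ∀ y a b x → y ℤ.+ (a ℤ.+ b) * x ℤ.- a * x ≡ y ℤ.+ b * x
    cancel = solve-∀

  signed-sum-L : ∀ n j → Σ< (suc n) (λ k → signed n k * + L k j) ≡ + S n j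
  signed-sum-L zero j = begin
    1ℤ * + S 0 0 * + L 0 j ℤ.+ 0ℤ   ≡⟨ cong (λ s → 1ℤ * + s * + L 0 j ℤ.+ 0ℤ) S.top ⟩
    1ℤ * + L 0 j ℤ.+ 0ℤ             ≡⟨ trans (ℤ.+-identityʳ _) (ℤ.*-identityˡ (+ L 0 j)) ⟩
    + L 0 j                         ≡⟨ cong +_ (tops j) ⟩
    + S 0 j                         ∎
    where
    tops : ∀ j → L 0 j ≡ S 0 j
    tops zero    = trans L.top (sym S.top)
    tops (suc j) = trans (L.top-suc j) (sym (S.top-suc j))
  signed-sum-L (suc n) zero = begin
    Σ< (suc (suc n)) (λ k → signed (suc n) k * + L k 0)
      ≡⟨ signed-sum-suc n (λ k → + L k 0) ⟩
    Σ< (suc n) (λ k → signed n k * (+ L (suc k) 0 ℤ.- + (k + r) * + L k 0))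
      ≡⟨ Σ<-cong (suc n) (λ {k} _ → trans (cong (signed n k *_) (L-edge-difference k))
           (exchange (signed n k) (+ r) (+ L k 0))) ⟩
    Σ< (suc n) (λ k → + r * (signed n k * + L k 0))
      ≡⟨ Σ<-*ˡ (suc n) (+ r) (λ k → signed n k * + L k 0) ⟩
    + r * Σ< (suc n) (λ k → signed n k * + L k 0)
      ≡⟨ cong (+ r *_) (signed-sum-L n 0) ⟩
    + r * + S n 0
      ≡⟨ trans (cong +_ (S.edge n)) (ℤ.pos-* r (S n 0)) ⟨
    + S (suc n) 0 ∎
    where
    exchange : ∀ s c x → s * (c * x) ≡ c * (s * x)
    exchange = solve-∀
  signed-sum-L (suc n) (suc j) = begin
    Σ< (suc (suc n)) (λ k → signed (suc n) k * + L k (suc j))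
      ≡⟨ signed-sum-suc n (λ k → + L k (suc j)) ⟩
    Σ< (suc n) (λ k → signed n k * (+ L (suc k) (suc j) ℤ.- + (k + r) * + L k (suc j)))
      ≡⟨ Σ<-cong (suc n) (λ {k} _ → trans (cong (signed n k *_) (L-inner-difference k j))
           (distribute (signed n k) (+ L k j) (+ (suc j + r)) (+ L k (suc j)))) ⟩
    Σ< (suc n) (λ k → signed n k * + L k j ℤ.+ + (suc j + r) * (signed n k * + L k (suc j)))
      ≡⟨ Σ<-+ (suc n) (λ k → signed n k * + L k j)
                      (λ k → + (suc j + r) * (signed n k * + L k (suc j))) ⟩
    Σ< (suc n) (λ k → signed n k * + L k j) ℤ.+
    Σ< (suc n) (λ k → + (suc j + r) * (signed n k * + L k (suc j)))
      ≡⟨ cong₂ ℤ._+_ (signed-sum-L n j)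
           (trans (Σ<-*ˡ (suc n) (+ (suc j + r)) (λ k → signed n k * + L k (suc j)))
                  (cong (+ (suc j + r) *_) (signed-sum-L n (suc j)))) ⟩
    + S n j ℤ.+ + (suc j + r) * + S n (suc j)
      ≡⟨ trans (cong +_ (S.inner n j)) (cong (λ z → + S n j ℤ.+ z) (ℤ.pos-* (suc j + r) (S n (suc j)))) ⟨
    + S (suc n) (suc j) ∎
    where
    distribute : ∀ s y c x → s * (y ℤ.+ c * x) ≡ s * y ℤ.+ c * (s * x)
    distribute = solve-∀

  ∑S-inversion : ∀ n → + ∑≤ n (S n) ≡
                 ∑ℤ≤ n (λ k → (-1ℤ ^ (n ∸ k)) * (+ S n k) * (+ ∑≤ k (L k)))
  ∑S-inversion n = sym (begin
    ∑ℤ≤ n (λ k → signed n k * (+ ∑≤ k (L k)))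
      ≡⟨ ∑ℤ≤-Σ< n (λ k → signed n k * (+ ∑≤ k (L k))) ⟩
    Σ< (suc n) (λ k → signed n k * (+ ∑≤ k (L k)))
      ≡⟨ Σ<-cong (suc n) (λ {k} k≤n → trans
           (cong (signed n k *_) (trans (∑≤-Σ< k (L k))
             -- Padding with the zeros beyond the diagonal gives all inner sums one range that does
             -- not depend on k, so that the order of summation can be exchanged.
             (Σ<-extend (λ j → + L k j) k≤n (λ k<j → cong +_ (L.vanish k<j)))))
           (sym (Σ<-*ˡ (suc n) (signed n k) (λ j → + L k j)))) ⟩
    Σ< (suc n) (λ k → Σ< (suc n) (λ j → signed n k * + L k j))
      ≡⟨ Σ<-swap (suc n) (suc n) (λ k j → signed n k * + L k j) ⟩
    Σ< (suc n) (λ j → Σ< (suc n) (λ k → signed n k * + L k j))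
      ≡⟨ Σ<-cong (suc n) (λ {j} _ → signed-sum-L n j) ⟩
    Σ< (suc n) (λ j → + S n j)
      ≡⟨ ∑≤-Σ< n (S n) ⟨
    + ∑≤ n (S n) ∎)

theorem4p1 : (r n : ℕ) →
    + rBell n r ≡
    ∑ℤ≤ n (λ k → (-1ℤ ^ (n ∸ k)) * (+ rStirling₂ r n k) * (+ ∑≤ k (λ j → rLah r k j)))
theorem4p1 r n = ∑S-inversion r (rPartitions-triangle setBlocks r) (rPartitions-triangle listBlocks r) n
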